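{- Let $s\in\mathbb{N}_0$. For $n\ge1$ and $1\le k\le n$, the generalized Stirling numbers $\mathfrak{S}_{s;h}(n,k|p,q)$ can be expressed as $$\mathfrak{S}_{s;h}(n,k|p,q)=h^{n-k}\sum_{\substack{\mathbf{k}\in\{0,1\}^{n-1}\\|\mathbf{k}|=n-k}}p^{\mathcal{P}_{n-1}(\mathbf{1},\mathbf{k})}\,q^{\mathcal{Q}_{n-1|s}(\mathbf{1},\mathbf{1},\mathbf{k})}\,\mathcal{A}_{n-1|s;p,q}(\mathbf{1},\mathbf{k}).$$
   Context: Let $X,Y,Z_p$ satisfy the relations of the $(p,q)$-deformed generalized Weyl algebra $A_{s;h|p,q}$: $XY-qYX=hY^sZ_p$, $Z_pY=pYZ_p$, $XZ_p=pZ_pX$, $Z_1=I$ ($s\in\mathbb{N}_0$, $h\in\mathbb{C}\setminus\{0\}$, $p,q\in\mathbb{C}$). The generalized Stirling numbers $\mathfrak{S}_{s;h}(n,k|p,q)$ are the normal ordering coefficients of $(YX)^n$: $$(YX)^n=\sum_{k=0}^n\mathfrak{S}_{s;h}(n,k|p,q)\,Y^{s(n-k)+k}Z_p^{n-k}X^k.$$ They satisfy the (known) recurrence $$\mathfrak{S}_{s;h}(n+1,k|p,q)=p^{n-k+1}q^{s(n-k+1)+k-1}\mathfrak{S}_{s;h}(n,k-1|p,q)+h[s(n-k)+k]_{p,q}\,\mathfrak{S}_{s;h}(n,k|p,q),$$ with $\mathfrak{S}_{s;h}(0,0|p,q)=1$ and $\mathfrak{S}_{s;h}(n,k|p,q)=0$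 unless $0\le k\le n$; this determines them. $[n]_{p,q}=\frac{p^n-q^n}{p-q}=\sum_{i=0}^{n-1}p^{n-1-i}q^i$. For $\mathbf{k}=(k_1,\dots,k_r)\in\{0,1\}^r$, $|\mathbf{k}|=\sum_jk_j$, and with $\mathbf{1}=(1,\dots,1)$ of length $r$, $$\mathcal{P}_r(\mathbf{1},\mathbf{k})=\sum_{j=1}^{r-1}(1-k_{j+1})\sum_{l=1}^jk_l,\qquad\mathcal{Q}_{r|s}(\mathbf{1},\mathbf{1},\mathbf{k})=\sum_{j=1}^r(1-k_j)\Big\{j+(s-1)\sum_{l=1}^{j-1}k_l\Big\},$$ $$\mathcal{A}_{r|s;p,q}(\mathbf{1},\mathbf{k})=\prod_{j=1}^r\prod_{\ell=0}^{k_j-1}\Big[j+(s-1)\sum_{l=1}^{j-1}k_l+(s-1)\ell\Big]_{p,q}.$$ Empty products are $1$ and empty sums are $0$. -}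

module Defs where

open import Algebra.Bundles using (CommutativeRing; Ring)
open import Algebra.Morphism.Structures using (module RingMorphisms)
import Algebra.Properties.Monoid.Sum as MonoidSum
import Algebra.Properties.Semiring.Exp as Exp
import Algebra.Properties.Semiring.Sum as SemiringSum
open import Data.Fin.Base using (Fin; Fin′; zero; suc; toℕ; inject; inject₁; fromℕ)
import Data.Fin.Properties as Fin
open import Data.Integer.Base as ℤ using (+_)
import Data.Integer.Properties as ℤ
import Data.Integer.Tactic.RingSolver as ℤ-Solver
open import Data.List.Base as List using (List; []; _∷_; allFin; cartesianProductWith; filter)
open import Data.Nat.Base as ℕ using (ℕ; zero; suc; _∸_; z≤n; s≤s)
import Data.Nat.Properties as ℕ
open import Data.Vec.Base using (Vec; []; _∷_; lookup)
open import Level using (_⊔_)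
open import Relation.Binary.PropositionalEquality as ≡ using (_≡_)
import Relation.Binary.Reasoning.Setoid as ≈-Reasoning

private
  module ℕΣ = MonoidSum ℕ.+-0-monoid

------------------------------------------------------------------------
-- Binary vectors and the exponents 𝒫, 𝒬

-- {0,1}ʳ.  A zero-based position j : Fin r stands for the index
-- suc (toℕ j) of the one-based notation k₁ , … , kᵣ.
Binary : ℕ → Set
Binary r = Vec (Fin 2) r

binaries : ∀ r → List (Binary r)
binaries zero    = [] ∷ []
binaries (suc r) = cartesianProductWith _∷_ (allFin 2) (binaries r)

entry : ∀ {r} → Binary r → Fin r → ℕ
entry 𝐤 j = toℕ (lookup 𝐤 j)

weight : ∀ {r} → Binary r → ℕ
weight {r} 𝐤 = ℕΣ.sum {r} (entry 𝐤)

-- The sum of the entries strictly before position j.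
before : ∀ {r} → Binary r → Fin r → ℕ
before 𝐤 j = ℕΣ.sum {toℕ j} (λ (l : Fin′ j) → entry 𝐤 (inject l))

-- j + (s - 1) m.  The truncated subtraction is exact when m ≤ j
-- (shift-exact), and it is only used with m < j (before≤).
shift : (s j m : ℕ) → ℕ
shift s j m = (j ℕ.+ s ℕ.* m) ∸ m

-- The position suc j is the index j + 1 of the sum over 1 ≤ j ≤ r - 1,
-- and the entries before it are k₁ , … , kⱼ.
𝒫 : ∀ {r} → Binary r → ℕ
𝒫 {zero}  𝐤 = 0
𝒫 {suc r} 𝐤 = ℕΣ.sum {r} (λ j → (1 ∸ entry 𝐤 (suc j)) ℕ.* before 𝐤 (suc j))

𝒬 : ∀ {r} → ℕ → Binary r → ℕ
𝒬 {r} s 𝐤 =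
  ℕΣ.sum {r} (λ j → (1 ∸ entry 𝐤 j) ℕ.* shift s (suc (toℕ j)) (before 𝐤 j))

shift-exact : ∀ s j m → m ℕ.≤ j → + shift s j m ≡ + j ℤ.+ (+ s ℤ.- + 1) ℤ.* + m
shift-exact s j m m≤j = begin
  + ((j ℕ.+ s ℕ.* m) ∸ m)              ≡⟨ ℤ.⊖-≥ (ℕ.≤-trans m≤j (ℕ.m≤m+n j _)) ⟨
  (j ℕ.+ s ℕ.* m) ℤ.⊖ m                ≡⟨ ℤ.m-n≡m⊖n (j ℕ.+ s ℕ.* m) m ⟨
  + j ℤ.+ + (s ℕ.* m) ℤ.- + m          ≡⟨ ≡.cong (λ x → + j ℤ.+ x ℤ.- + m) (ℤ.pos-* s m) ⟩
  + j ℤ.+ + s ℤ.* + m ℤ.- + m          ≡⟨ regroup (+ j) (+ s) (+ m) ⟩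
  + j ℤ.+ (+ s ℤ.- + 1) ℤ.* + m        ∎
  where
  open ≡.≡-Reasoning
  regroup : ∀ a b c → a ℤ.+ b ℤ.* c ℤ.- c ≡ a ℤ.+ (b ℤ.- + 1) ℤ.* c
  regroup = ℤ-Solver.solve-∀

before≤ : ∀ {r} (𝐤 : Binary r) j → before 𝐤 j ℕ.≤ toℕ j
before≤ (k ∷ 𝐤) zero    = z≤n
before≤ (k ∷ 𝐤) (suc j) = ℕ.+-mono-≤ (Fin.toℕ≤pred[n] k) (before≤ 𝐤 j)

------------------------------------------------------------------------
-- The generalized Stirling numbers over a commutative ring of scalars

module Stirling {c ℓ} (R : CommutativeRing c ℓ) where

  open CommutativeRing R hiding (zero)
  open Exp semiring public using (_^_)
  open SemiringSum semiring using (sum; sum-cong-≋; *-distribˡ-sum)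
  private
    module Π = MonoidSum *-monoid

  -- The polynomial form of (pⁿ - qⁿ) / (p - q), meaningful also for p = q.
  [_]⟨_,_⟩ : ℕ → Carrier → Carrier → Carrier
  [ n ]⟨ p , q ⟩ = sum {n} (λ i → p ^ (n ∸ 1 ∸ toℕ i) * q ^ toℕ i)

  -- The recurrence that determines the normal ordering coefficients of
  -- (Y X)ⁿ; normal-ordering below shows that they are such coefficients.
  -- The clauses truncate n - k only when k > n, where 𝔖 vanishes
  -- (𝔖-vanishes).
  𝔖 : (s : ℕ) (h p q : Carrier) (n k : ℕ) → Carrier
  𝔖 s h p q zero    zero    = 1#
  𝔖 s h p q zero    (suc k) = 0#
  𝔖 s h p q (suc n) zero    = h * [ s ℕ.* n ]⟨ p , q ⟩ * 𝔖 s h p q n zero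
  𝔖 s h p q (suc n) (suc k) =
      p ^ (n ∸ k) * q ^ (s ℕ.* (n ∸ k) ℕ.+ k) * 𝔖 s h p q n k
    + h * [ s ℕ.* (n ∸ suc k) ℕ.+ suc k ]⟨ p , q ⟩ * 𝔖 s h p q n (suc k)

  -- (s - 1) ∑ₗ kₗ + (s - 1) ℓ is combined into (s - 1) (∑ₗ kₗ + ℓ).
  𝒜 : ∀ {r} → ℕ → (p q : Carrier) → Binary r → Carrier
  𝒜 {r} s p q 𝐤 =
    Π.sum {r} (λ j → Π.sum {entry 𝐤 j} (λ ℓ →
      [ shift s (suc (toℕ j)) (before 𝐤 j ℕ.+ toℕ ℓ) ]⟨ p , q ⟩))

  -- The sum of f over all 𝐤 ∈ {0,1}ʳ with |𝐤| = w.
  sumOfWeight : (r w : ℕ) → (Binary r → Carrier) → Carrier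
  sumOfWeight r w f =
    List.foldr _+_ 0# (List.map f (filter (λ 𝐤 → weight 𝐤 ℕ.≟ w) (binaries r)))

  𝔖-vanishes : ∀ s h p q {n k} → n ℕ.< k → 𝔖 s h p q n k ≈ 0#
  𝔖-vanishes s h p q {zero}  {suc k} _         = refl
  𝔖-vanishes s h p q {suc n} {suc k} (s≤s n<k) = trans
    (+-cong (trans (*-congˡ (𝔖-vanishes s h p q n<k)) (zeroʳ _))
            (trans (*-congˡ (𝔖-vanishes s h p q (ℕ.m<n⇒m<1+n n<k))) (zeroʳ _)))
    (+-identityˡ 0#)

  bracket-suc : ∀ p q n → [ suc n ]⟨ p , q ⟩ ≈ p ^ n + q * [ n ]⟨ p , q ⟩
  bracket-suc p q n = +-cong (*-identityʳ _)
    (trans (sum-cong-≋ {n} term) (sym (*-distribˡ-sum {n} q _)))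
    where
    term : ∀ i → p ^ (n ∸ suc (toℕ i)) * q ^ suc (toℕ i)
               ≈ q * (p ^ (n ∸ 1 ∸ toℕ i) * q ^ toℕ i)
    term i = begin
      p ^ (n ∸ suc (toℕ i)) * (q * q ^ toℕ i)
        ≡⟨ ≡.cong (λ e → p ^ e * (q * q ^ toℕ i)) (ℕ.∸-+-assoc n 1 (toℕ i)) ⟨
      p ^ (n ∸ 1 ∸ toℕ i) * (q * q ^ toℕ i)
        ≈⟨ *-assoc _ _ _ ⟨
      p ^ (n ∸ 1 ∸ toℕ i) * q * q ^ toℕ i
        ≈⟨ *-congʳ (*-comm _ _) ⟩
      q * p ^ (n ∸ 1 ∸ toℕ i) * q ^ toℕ i
        ≈⟨ *-assoc _ _ _ ⟩
      q * (p ^ (n ∸ 1 ∸ toℕ i) * q ^ toℕ i) ∎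
      where open ≈-Reasoning setoid

------------------------------------------------------------------------
-- The (p,q)-deformed generalized Weyl algebra

-- An R-algebra, given by a central homomorphism ι from R, with elements
-- X, Y and Z = Zₚ satisfying the defining relations.
record DeformedWeyl {c ℓ c′ ℓ′} (R : CommutativeRing c ℓ) (A : Ring c′ ℓ′)
                    (s : ℕ) (h p q : CommutativeRing.Carrier R)
                    : Set (c ⊔ ℓ ⊔ c′ ⊔ ℓ′) where
  private
    module R = CommutativeRing R
  open Ring A hiding (zero)
  open Exp semiring using (_^_)
  open RingMorphisms R.rawRing rawRing using (IsRingHomomorphism)
  field
    ι         : R.Carrier → Carrier
    ι-hom     : IsRingHomomorphism ι
    ι-central : ∀ c x → ι c * x ≈ x * ι c
    X Y Z     : Carrier
    XY-qYX    : X * Y - ι q * (Y * X) ≈ ι h * (Y ^ s * Z)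
    ZY        : Z * Y ≈ ι p * (Y * Z)
    XZ        : X * Z ≈ ι p * (Z * X)
    Z₁        : p R.≈ R.1# → Z ≈ 1#

module NormalOrdering {c ℓ c′ ℓ′} {R : CommutativeRing c ℓ} {A : Ring c′ ℓ′}
                      {s : ℕ} {h p q : CommutativeRing.Carrier R}
                      (W : DeformedWeyl R A s h p q) where

  private
    module R = CommutativeRing R
    module RE = Exp R.semiring
  open DeformedWeyl W
  open Ring A hiding (zero)
  open Exp semiring using (_^_; ^-homo-*; ^-congʳ)
  open SemiringSum semiring
    using (sum; sum-cong-≋; *-distribˡ-sum; ∑-distrib-+; sum-init-last)
  open RingMorphisms R.rawRing rawRing using (module IsRingHomomorphism)
  open IsRingHomomorphism ι-hom
    using (⟦⟧-cong; *-homo; +-homo; 1#-homo; 0#-homo)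
  open Stirling R hiding (_^_)
  open ≈-Reasoning setoid

  infixl 7 _·_
  _·_ : R.Carrier → Carrier → Carrier
  c · x = ι c * x

  -- The normally ordered monomial belonging to 𝔖 (n , k).
  monomial : (n k : ℕ) → Carrier
  monomial n k = Y ^ (s ℕ.* (n ∸ k) ℕ.+ k) * (Z ^ (n ∸ k) * X ^ k)

  private
    ·-cong : ∀ {c d x y} → c R.≈ d → x ≈ y → c · x ≈ d · y
    ·-cong c≈d x≈y = *-cong (⟦⟧-cong c≈d) x≈y

    ·-congˡ : ∀ {c x y} → x ≈ y → c · x ≈ c · y
    ·-congˡ = *-congˡ

    ·-pull : ∀ c x y → x * (c · y) ≈ c · (x * y)
    ·-pull c x y = begin
      x * (ι c * y) ≈⟨ *-assoc _ _ _ ⟨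
      x * ι c * y   ≈⟨ *-congʳ (ι-central c x) ⟨
      ι c * x * y   ≈⟨ *-assoc _ _ _ ⟩
      ι c * (x * y) ∎

    ·-assoc : ∀ c d x → c · (d · x) ≈ (c R.* d) · x
    ·-assoc c d x = trans (sym (*-assoc _ _ _)) (*-congʳ (sym (*-homo c d)))

    ·-distribʳ : ∀ c d x → (c R.+ d) · x ≈ c · x + d · x
    ·-distribʳ c d x = trans (*-congʳ (+-homo c d)) (distribʳ _ _ _)

    ·-identity : ∀ x → R.1# · x ≈ x
    ·-identity x = trans (*-congʳ 1#-homo) (*-identityˡ x)

    ·-zero : ∀ x → R.0# · x ≈ 0#
    ·-zero x = trans (*-congʳ 0#-homo) (zeroˡ x)

    XY : X * Y ≈ q · (Y * X) + h · (Y ^ s * Z)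
    XY = begin
      X * Y                                   ≈⟨ +-identityʳ _ ⟨
      X * Y + 0#                              ≈⟨ +-congˡ (-‿inverseˡ _) ⟨
      X * Y + (- (q · (Y * X)) + q · (Y * X)) ≈⟨ +-assoc _ _ _ ⟨
      X * Y - q · (Y * X) + q · (Y * X)       ≈⟨ +-congʳ XY-qYX ⟩
      h · (Y ^ s * Z) + q · (Y * X)           ≈⟨ +-comm _ _ ⟩
      q · (Y * X) + h · (Y ^ s * Z)           ∎

    ZYᵃ : ∀ a → Z * Y ^ a ≈ (p RE.^ a) · (Y ^ a * Z)
    ZYᵃ zero    = trans (*-identityʳ Z) (sym (trans (·-identity _) (*-identityˡ Z)))
    ZYᵃ (suc a) = begin
      Z * (Y * Y ^ a)                      ≈⟨ *-assoc _ _ _ ⟨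
      Z * Y * Y ^ a                        ≈⟨ *-congʳ ZY ⟩
      p · (Y * Z) * Y ^ a                  ≈⟨ *-assoc _ _ _ ⟩
      p · (Y * Z * Y ^ a)                  ≈⟨ ·-congˡ (*-assoc _ _ _) ⟩
      p · (Y * (Z * Y ^ a))                ≈⟨ ·-congˡ (*-congˡ (ZYᵃ a)) ⟩
      p · (Y * ((p RE.^ a) · (Y ^ a * Z))) ≈⟨ ·-congˡ (·-pull _ _ _) ⟩
      p · ((p RE.^ a) · (Y * (Y ^ a * Z))) ≈⟨ ·-assoc _ _ _ ⟩
      (p RE.^ suc a) · (Y * (Y ^ a * Z))   ≈⟨ ·-congˡ (*-assoc _ _ _) ⟨
      (p RE.^ suc a) · (Y ^ suc a * Z)     ∎

    XZᵐ : ∀ m → X * Z ^ m ≈ (p RE.^ m) · (Z ^ m * X)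
    XZᵐ zero    = trans (*-identityʳ X) (sym (trans (·-identity _) (*-identityˡ X)))
    XZᵐ (suc m) = begin
      X * (Z * Z ^ m)                      ≈⟨ *-assoc _ _ _ ⟨
      X * Z * Z ^ m                        ≈⟨ *-congʳ XZ ⟩
      p · (Z * X) * Z ^ m                  ≈⟨ *-assoc _ _ _ ⟩
      p · (Z * X * Z ^ m)                  ≈⟨ ·-congˡ (*-assoc _ _ _) ⟩
      p · (Z * (X * Z ^ m))                ≈⟨ ·-congˡ (*-congˡ (XZᵐ m)) ⟩
      p · (Z * ((p RE.^ m) · (Z ^ m * X))) ≈⟨ ·-congˡ (·-pull _ _ _) ⟩
      p · ((p RE.^ m) · (Z * (Z ^ m * X))) ≈⟨ ·-assoc _ _ _ ⟩
      (p RE.^ suc m) · (Z * (Z ^ m * X))   ≈⟨ ·-congˡ (*-assoc _ _ _) ⟨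
      (p RE.^ suc m) · (Z ^ suc m * X)     ∎

    -- Multiplying by Y on the left avoids the exponent a + s - 1.
    YXYᵃ : ∀ a → Y * X * Y ^ a ≈ (q RE.^ a) · (Y ^ suc a * X)
                               + (h R.* [ a ]⟨ p , q ⟩) · (Y ^ (s ℕ.+ a) * Z)
    YXYᵃ zero = begin
      Y * X * 1#                ≈⟨ *-identityʳ _ ⟩
      Y * X                     ≈⟨ *-congʳ (*-identityʳ Y) ⟨
      Y ^ 1 * X                 ≈⟨ ·-identity _ ⟨
      R.1# · (Y ^ 1 * X)        ≈⟨ +-identityʳ _ ⟨
      R.1# · (Y ^ 1 * X) + 0#   ≈⟨ +-congˡ (trans (·-cong (R.zeroʳ h) refl) (·-zero _)) ⟨
      R.1# · (Y ^ 1 * X) + (h R.* R.0#) · (Y ^ (s ℕ.+ 0) * Z) ∎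
    YXYᵃ (suc a) = begin
      Y * X * (Y * Y ^ a)
        ≈⟨ trans (*-assoc _ _ _) (*-congˡ (trans (sym (*-assoc _ _ _)) (*-congʳ XY))) ⟩
      Y * ((q · (Y * X) + h · (Y ^ s * Z)) * Y ^ a)
        ≈⟨ *-congˡ (distribʳ _ _ _) ⟩
      Y * (q · (Y * X) * Y ^ a + h · (Y ^ s * Z) * Y ^ a)
        ≈⟨ distribˡ _ _ _ ⟩
      Y * (q · (Y * X) * Y ^ a) + Y * (h · (Y ^ s * Z) * Y ^ a)
        ≈⟨ +-cong left right ⟩
      (c₁ · M₁ + (q R.* (h R.* [ a ]⟨ p , q ⟩)) · M₂) + (h R.* p RE.^ a) · M₂
        ≈⟨ +-assoc _ _ _ ⟩
      c₁ · M₁ + ((q R.* (h R.* [ a ]⟨ p , q ⟩)) · M₂ + (h R.* p RE.^ a) · M₂)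
        ≈⟨ +-congˡ (·-distribʳ _ _ _) ⟨
      c₁ · M₁ + (q R.* (h R.* [ a ]⟨ p , q ⟩) R.+ h R.* p RE.^ a) · M₂
        ≈⟨ +-congˡ (·-cong coefficient refl) ⟩
      c₁ · M₁ + (h R.* [ suc a ]⟨ p , q ⟩) · M₂ ∎
      where
      c₁ = q RE.^ suc a
      M₁ = Y ^ suc (suc a) * X
      M₂ = Y ^ (s ℕ.+ suc a) * Z

      Y-Yˢ⁺ᵃ : Y * Y ^ (s ℕ.+ a) ≈ Y ^ (s ℕ.+ suc a)
      Y-Yˢ⁺ᵃ = ^-congʳ Y (≡.sym (ℕ.+-suc s a))

      left : Y * (q · (Y * X) * Y ^ a) ≈ c₁ · M₁ + (q R.* (h R.* [ a ]⟨ p , q ⟩)) · M₂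
      left = begin
        Y * (q · (Y * X) * Y ^ a)   ≈⟨ *-congˡ (*-assoc _ _ _) ⟩
        Y * (q · (Y * X * Y ^ a))   ≈⟨ ·-pull _ _ _ ⟩
        q · (Y * (Y * X * Y ^ a))   ≈⟨ ·-congˡ (*-congˡ (YXYᵃ a)) ⟩
        q · (Y * ((q RE.^ a) · (Y ^ suc a * X)
                 + (h R.* [ a ]⟨ p , q ⟩) · (Y ^ (s ℕ.+ a) * Z)))
          ≈⟨ ·-congˡ (trans (distribˡ _ _ _) (+-cong (·-pull _ _ _) (·-pull _ _ _))) ⟩
        q · ((q RE.^ a) · (Y * (Y ^ suc a * X))
            + (h R.* [ a ]⟨ p , q ⟩) · (Y * (Y ^ (s ℕ.+ a) * Z)))
          ≈⟨ trans (distribˡ _ _ _) (+-cong (·-assoc _ _ _) (·-assoc _ _ _)) ⟩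
        c₁ · (Y * (Y ^ suc a * X))
          + (q R.* (h R.* [ a ]⟨ p , q ⟩)) · (Y * (Y ^ (s ℕ.+ a) * Z))
          ≈⟨ +-cong (·-congˡ (sym (*-assoc _ _ _)))
                    (·-congˡ (trans (sym (*-assoc _ _ _)) (*-congʳ Y-Yˢ⁺ᵃ))) ⟩
        c₁ · M₁ + (q R.* (h R.* [ a ]⟨ p , q ⟩)) · M₂ ∎

      right : Y * (h · (Y ^ s * Z) * Y ^ a) ≈ (h R.* p RE.^ a) · M₂
      right = begin
        Y * (h · (Y ^ s * Z) * Y ^ a)
          ≈⟨ *-congˡ (trans (*-assoc _ _ _) (·-congˡ (*-assoc _ _ _))) ⟩
        Y * (h · (Y ^ s * (Z * Y ^ a)))
          ≈⟨ trans (·-pull _ _ _) (·-congˡ (*-congˡ (*-congˡ (ZYᵃ a)))) ⟩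
        h · (Y * (Y ^ s * ((p RE.^ a) · (Y ^ a * Z))))
          ≈⟨ ·-congˡ (trans (*-congˡ (·-pull _ _ _)) (·-pull _ _ _)) ⟩
        h · ((p RE.^ a) · (Y * (Y ^ s * (Y ^ a * Z))))
          ≈⟨ ·-assoc _ _ _ ⟩
        (h R.* p RE.^ a) · (Y * (Y ^ s * (Y ^ a * Z)))
          ≈⟨ ·-congˡ (*-congˡ (trans (sym (*-assoc _ _ _)) (*-congʳ (sym (^-homo-* Y s a))))) ⟩
        (h R.* p RE.^ a) · (Y * (Y ^ (s ℕ.+ a) * Z))
          ≈⟨ ·-congˡ (trans (sym (*-assoc _ _ _)) (*-congʳ Y-Yˢ⁺ᵃ)) ⟩
        (h R.* p RE.^ a) · M₂ ∎

      coefficient : q R.* (h R.* [ a ]⟨ p , q ⟩) R.+ h R.* p RE.^ a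
                    R.≈ h R.* [ suc a ]⟨ p , q ⟩
      coefficient =
        R.trans (R.+-comm _ _) (R.trans (R.+-congˡ (R.trans (R.sym (R.*-assoc _ _ _))
          (R.trans (R.*-congʳ (R.*-comm q h)) (R.*-assoc _ _ _))))
        (R.trans (R.sym (R.distribˡ _ _ _)) (R.*-congˡ (R.sym (bracket-suc p q a)))))

    up stay : (n k : ℕ) → R.Carrier
    up   n k = p RE.^ (n ∸ k) R.* q RE.^ (s ℕ.* (n ∸ k) ℕ.+ k)
    stay n k = h R.* [ s ℕ.* (n ∸ k) ℕ.+ k ]⟨ p , q ⟩

    YX-monomial : ∀ n k → k ℕ.≤ n → Y * X * monomial n k
      ≈ up n k · monomial (suc n) (suc k) + stay n k · monomial (suc n) k
    YX-monomial n k k≤n = begin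
      Y * X * (Y ^ a * (Z ^ m * X ^ k))
        ≈⟨ *-assoc _ _ _ ⟨
      Y * X * Y ^ a * (Z ^ m * X ^ k)
        ≈⟨ *-congʳ (YXYᵃ a) ⟩
      ((q RE.^ a) · (Y ^ suc a * X) + stay n k · (Y ^ (s ℕ.+ a) * Z)) * (Z ^ m * X ^ k)
        ≈⟨ distribʳ _ _ _ ⟩
      (q RE.^ a) · (Y ^ suc a * X) * (Z ^ m * X ^ k)
        + stay n k · (Y ^ (s ℕ.+ a) * Z) * (Z ^ m * X ^ k)
        ≈⟨ +-cong raise keep ⟩
      up n k · monomial (suc n) (suc k) + stay n k · monomial (suc n) k ∎
      where
      m = n ∸ k
      a = s ℕ.* m ℕ.+ k

      raise : (q RE.^ a) · (Y ^ suc a * X) * (Z ^ m * X ^ k)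
              ≈ up n k · monomial (suc n) (suc k)
      raise = begin
        (q RE.^ a) · (Y ^ suc a * X) * (Z ^ m * X ^ k)
          ≈⟨ trans (*-assoc _ _ _) (·-congˡ (*-assoc _ _ _)) ⟩
        (q RE.^ a) · (Y ^ suc a * (X * (Z ^ m * X ^ k)))
          ≈⟨ ·-congˡ (*-congˡ (trans (sym (*-assoc _ _ _)) (*-congʳ (XZᵐ m)))) ⟩
        (q RE.^ a) · (Y ^ suc a * ((p RE.^ m) · (Z ^ m * X) * X ^ k))
          ≈⟨ ·-congˡ (*-congˡ (trans (*-assoc _ _ _) (·-congˡ (*-assoc _ _ _)))) ⟩
        (q RE.^ a) · (Y ^ suc a * ((p RE.^ m) · (Z ^ m * X ^ suc k)))
          ≈⟨ trans (·-congˡ (·-pull _ _ _)) (·-assoc _ _ _) ⟩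
        (q RE.^ a R.* p RE.^ m) · (Y ^ suc a * (Z ^ m * X ^ suc k))
          ≈⟨ ·-cong (R.*-comm _ _) (*-congʳ (^-congʳ Y (≡.sym (ℕ.+-suc (s ℕ.* m) k)))) ⟩
        up n k · monomial (suc n) (suc k) ∎

      keep : stay n k · (Y ^ (s ℕ.+ a) * Z) * (Z ^ m * X ^ k)
             ≈ stay n k · monomial (suc n) k
      keep = begin
        stay n k · (Y ^ (s ℕ.+ a) * Z) * (Z ^ m * X ^ k)
          ≈⟨ trans (*-assoc _ _ _) (·-congˡ (*-assoc _ _ _)) ⟩
        stay n k · (Y ^ (s ℕ.+ a) * (Z * (Z ^ m * X ^ k)))
          ≈⟨ ·-congˡ (*-congˡ (*-assoc _ _ _)) ⟨
        stay n k · (Y ^ (s ℕ.+ a) * (Z ^ suc m * X ^ k))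
          ≡⟨ ≡.cong (λ e → stay n k · (Y ^ e * (Z ^ suc m * X ^ k))) exponent ⟩
        stay n k · (Y ^ (s ℕ.* suc m ℕ.+ k) * (Z ^ suc m * X ^ k))
          ≡⟨ ≡.cong (λ e → stay n k · (Y ^ (s ℕ.* e ℕ.+ k) * (Z ^ e * X ^ k)))
                    (≡.sym (ℕ.+-∸-assoc 1 k≤n)) ⟩
        stay n k · monomial (suc n) k ∎
        where
        exponent : s ℕ.+ a ≡ s ℕ.* suc m ℕ.+ k
        exponent = ≡.trans (≡.sym (ℕ.+-assoc s (s ℕ.* m) k))
                           (≡.cong (ℕ._+ k) (≡.sym (ℕ.*-suc s m)))

  normal-ordering : ∀ n →
    (Y * X) ^ n ≈ sum {suc n} (λ k → 𝔖 s h p q n (toℕ k) · monomial n (toℕ k))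
  normal-ordering zero = sym (begin
    R.1# · monomial 0 0 + 0#  ≈⟨ +-identityʳ _ ⟩
    R.1# · monomial 0 0       ≈⟨ ·-identity _ ⟩
    Y ^ (s ℕ.* 0 ℕ.+ 0) * (1# * 1#)
      ≈⟨ *-cong (^-congʳ Y (≡.trans (ℕ.+-identityʳ _) (ℕ.*-zeroʳ s))) (*-identityˡ 1#) ⟩
    1# * 1#                   ≈⟨ *-identityˡ 1# ⟩
    1#                        ∎)
  normal-ordering (suc n) = begin
    Y * X * (Y * X) ^ n
      ≈⟨ *-congˡ (normal-ordering n) ⟩
    Y * X * sum {suc n} (λ k → S (toℕ k) · monomial n (toℕ k))
      ≈⟨ *-distribˡ-sum {suc n} (Y * X) (λ k → S (toℕ k) · monomial n (toℕ k)) ⟩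
    sum {suc n} (λ k → Y * X * (S (toℕ k) · monomial n (toℕ k)))
      ≈⟨ sum-cong-≋ {suc n} (λ k → split (toℕ k) (Fin.toℕ≤pred[n] k)) ⟩
    sum {suc n} (λ k → U (toℕ k) + V (toℕ k))
      ≈⟨ ∑-distrib-+ {suc n} (λ k → U (toℕ k)) (λ k → V (toℕ k)) ⟩
    sum {suc n} (λ k → U (toℕ k)) + sum {suc n} (λ k → V (toℕ k))
      ≈⟨ +-congˡ extend ⟩
    sum {suc n} (λ k → U (toℕ k)) + (V 0 + sum {suc n} (λ k → V (suc (toℕ k))))
      ≈⟨ trans (sym (+-assoc _ _ _)) (trans (+-congʳ (+-comm _ _)) (+-assoc _ _ _)) ⟩
    V 0 + (sum {suc n} (λ k → U (toℕ k)) + sum {suc n} (λ k → V (suc (toℕ k))))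
      ≈⟨ +-congˡ (∑-distrib-+ {suc n} (λ k → U (toℕ k)) (λ k → V (suc (toℕ k)))) ⟨
    V 0 + sum {suc n} (λ k → U (toℕ k) + V (suc (toℕ k)))
      ≈⟨ +-cong head (sum-cong-≋ {suc n} (λ k → merge (toℕ k))) ⟩
    sum {suc (suc n)} (λ k → 𝔖 s h p q (suc n) (toℕ k) · monomial (suc n) (toℕ k)) ∎
    where
    S : ℕ → R.Carrier
    S k = 𝔖 s h p q n k

    U V : ℕ → Carrier
    U k = (up n k R.* S k) · monomial (suc n) (suc k)
    V k = (stay n k R.* S k) · monomial (suc n) k

    split : ∀ k → k ℕ.≤ n → Y * X * (S k · monomial n k) ≈ U k + V k
    split k k≤n = begin
      Y * X * (S k · monomial n k)
        ≈⟨ trans (·-pull _ _ _) (·-congˡ (YX-monomial n k k≤n)) ⟩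
      S k · (up n k · monomial (suc n) (suc k) + stay n k · monomial (suc n) k)
        ≈⟨ trans (distribˡ _ _ _) (+-cong (·-assoc _ _ _) (·-assoc _ _ _)) ⟩
      (S k R.* up n k) · monomial (suc n) (suc k) + (S k R.* stay n k) · monomial (suc n) k
        ≈⟨ +-cong (·-cong (R.*-comm _ _) refl) (·-cong (R.*-comm _ _) refl) ⟩
      U k + V k ∎

    merge : ∀ k → U k + V (suc k) ≈ 𝔖 s h p q (suc n) (suc k) · monomial (suc n) (suc k)
    merge k = sym (·-distribʳ (up n k R.* S k) (stay n (suc k) R.* S (suc k)) _)

    last≈0 : V (suc n) ≈ 0#
    last≈0 = trans
      (·-cong (R.trans (R.*-congˡ (𝔖-vanishes s h p q (ℕ.n<1+n n))) (R.zeroʳ _)) refl)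
      (·-zero _)

    extend : sum {suc n} (λ k → V (toℕ k)) ≈ V 0 + sum {suc n} (λ k → V (suc (toℕ k)))
    extend = begin
      sum {suc n} (λ k → V (toℕ k))
        ≈⟨ +-identityʳ _ ⟨
      sum {suc n} (λ k → V (toℕ k)) + 0#
        ≈⟨ +-cong (sum-cong-≋ {suc n} (λ k → reflexive (≡.cong V (≡.sym (Fin.toℕ-inject₁ k)))))
                  (sym (trans (reflexive (≡.cong V (Fin.toℕ-fromℕ (suc n)))) last≈0)) ⟩
      sum {suc n} (λ k → V (toℕ (inject₁ k))) + V (toℕ (fromℕ (suc n)))
        ≈⟨ sum-init-last {suc n} (λ k → V (toℕ k)) ⟨
      sum {suc (suc n)} (λ k → V (toℕ k)) ∎

    head : V 0 ≈ 𝔖 s h p q (suc n) 0 · monomial (suc n) 0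
    head = ·-cong (R.*-congʳ (R.*-congˡ (R.reflexive
      (≡.cong (λ e → [ e ]⟨ p , q ⟩) (ℕ.+-identityʳ (s ℕ.* n)))))) refl

{-# OPTIONS --safe #-}

-- Appending an entry x to a binary vector 𝐤 multiplies the summand by
-- p^m q^(k + s m) if x = 0 and by [k + s m] if x = 1, where m = |𝐤| and m + k
-- is the length of 𝐤 ∷ʳ x.  Up to the factor h in the second case, these are
-- the two coefficients of the recurrence for 𝔖.

module Submission where

open import Defs
open import Algebra.Bundles using (CommutativeRing; Monoid)
import Algebra.Properties.CommutativeSemigroup as CommutativeSemigroupProperties
import Algebra.Properties.Monoid.Sum as MonoidSum
import Algebra.Properties.Semiring.Exp as Exp
import Algebra.Solver.CommutativeMonoid as CommutativeMonoidSolver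
open import Data.Bool.Base using (true; false)
open import Data.Fin.Base using (zero; suc; toℕ; inject₁; fromℕ)
import Data.Fin.Properties as Fin
open import Data.List.Base using (List; []; _∷_; _++_; filter; foldr; map)
open import Data.List.Properties using (filter-none; filter-≐; ++-identityʳ)
import Data.List.Relation.Unary.All as All
open import Data.Nat.Base as ℕ using (ℕ; zero; suc; _∸_; _≤_; _<_)
import Data.Nat.Properties as ℕ
open import Data.Product.Base using (_,_)
open import Data.Vec.Base using ([]; _∷_; _∷ʳ_)
open import Function.Base using (_∘_)
open import Relation.Binary.PropositionalEquality as ≡ using (_≡_)
import Relation.Binary.Reasoning.Setoid as ≈-Reasoning
open import Relation.Nullary.Decidable.Core using (does; yes; no)
open import Relation.Nullary.Negation.Core using (¬_; contradiction)
open import Relation.Unary using (Decidable; _≐_)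

private
  module ℕΣ = MonoidSum ℕ.+-0-monoid

pattern 0ᵇ = zero
pattern 1ᵇ = suc zero

-- Entries, prefix sums and weight after appending an entry.

entry-∷ʳ : ∀ {r} (𝐤 : Binary r) x j → entry (𝐤 ∷ʳ x) (inject₁ j) ≡ entry 𝐤 j
entry-∷ʳ (k ∷ 𝐤) x zero    = ≡.refl
entry-∷ʳ (k ∷ 𝐤) x (suc j) = entry-∷ʳ 𝐤 x j

entry-last : ∀ {r} (𝐤 : Binary r) x → entry (𝐤 ∷ʳ x) (fromℕ r) ≡ toℕ x
entry-last []      x = ≡.refl
entry-last (k ∷ 𝐤) x = entry-last 𝐤 x

before-∷ʳ : ∀ {r} (𝐤 : Binary r) x j → before (𝐤 ∷ʳ x) (inject₁ j) ≡ before 𝐤 j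
before-∷ʳ (k ∷ 𝐤) x zero    = ≡.refl
before-∷ʳ (k ∷ 𝐤) x (suc j) = ≡.cong (toℕ k ℕ.+_) (before-∷ʳ 𝐤 x j)

before-last : ∀ {r} (𝐤 : Binary r) x → before (𝐤 ∷ʳ x) (fromℕ r) ≡ weight 𝐤
before-last []      x = ≡.refl
before-last (k ∷ 𝐤) x = ≡.cong (toℕ k ℕ.+_) (before-last 𝐤 x)

weight-∷ʳ : ∀ {r} (𝐤 : Binary r) x → weight (𝐤 ∷ʳ x) ≡ toℕ x ℕ.+ weight 𝐤
weight-∷ʳ []      x = ≡.refl
weight-∷ʳ (k ∷ 𝐤) x =
  ≡.trans (≡.cong (toℕ k ℕ.+_) (weight-∷ʳ 𝐤 x)) (x∙yz≈y∙xz (toℕ k) (toℕ x) (weight 𝐤))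
  where open CommutativeSemigroupProperties ℕ.+-commutativeSemigroup

weight≤ : ∀ {r} (𝐤 : Binary r) → weight 𝐤 ≤ r
weight≤ []      = ℕ.z≤n
weight≤ (k ∷ 𝐤) = ℕ.+-mono-≤ (Fin.toℕ≤pred[n] k) (weight≤ 𝐤)

-- Translates between two notations: `shift` occurs in `𝒬` and `𝒜`, the right-hand form in the
-- recurrence for `𝔖`. Writing the position as m + k makes the truncated subtraction exact.
shift-+ : ∀ s m k → shift s (m ℕ.+ k) m ≡ s ℕ.* m ℕ.+ k
shift-+ s m k = begin
  (m ℕ.+ k ℕ.+ s ℕ.* m) ∸ m   ≡⟨ ≡.cong (_∸ m) (ℕ.+-assoc m k (s ℕ.* m)) ⟩
  (m ℕ.+ (k ℕ.+ s ℕ.* m)) ∸ m ≡⟨ ℕ.m+n∸m≡n m (k ℕ.+ s ℕ.* m) ⟩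
  k ℕ.+ s ℕ.* m               ≡⟨ ℕ.+-comm k (s ℕ.* m) ⟩
  s ℕ.* m ℕ.+ k               ∎
  where open ≡.≡-Reasoning

-- Sums over positions after appending an entry.

module _ {c ℓ} (M : Monoid c ℓ) where

  open Monoid M
  open MonoidSum M using (sum; sum-cong-≋; sum-init-last)

  -- Appending x changes neither the entries nor the prefix sums at the old positions, so there is
  -- just one new term, whose prefix sum is the whole weight. An arbitrary monoid covers the sums
  -- `𝒫` and `𝒬` as well as the product `𝒜`. Positions are zero-based, so the new one is r.
  sum-∷ʳ : ∀ {r} (g : (position before entry : ℕ) → Carrier) (𝐤 : Binary r) x →
    sum {suc r} (λ j → g (toℕ j) (before (𝐤 ∷ʳ x) j) (entry (𝐤 ∷ʳ x) j)) ≈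
    sum {r} (λ j → g (toℕ j) (before 𝐤 j) (entry 𝐤 j)) ∙ g r (weight 𝐤) (toℕ x)
  sum-∷ʳ {r} g 𝐤 x = trans
    (sum-init-last {r} (λ j → g (toℕ j) (before (𝐤 ∷ʳ x) j) (entry (𝐤 ∷ʳ x) j)))
    (∙-cong
      (sum-cong-≋ {r} (λ j →
        g-cong (Fin.toℕ-inject₁ j) (before-∷ʳ 𝐤 x j) (entry-∷ʳ 𝐤 x j)))
      (g-cong (Fin.toℕ-fromℕ r) (before-last 𝐤 x) (entry-last 𝐤 x)))
    where
    g-cong : ∀ {a a′ b b′ c c′} → a ≡ a′ → b ≡ b′ → c ≡ c′ → g a b c ≈ g a′ b′ c′
    g-cong ≡.refl ≡.refl ≡.refl = refl

-- The first position has prefix sum 0, so its term vanishes. The longer sum has the shape that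
-- `sum-∷ʳ` handles.
𝒫-full : ∀ {r} (𝐤 : Binary r) →
  𝒫 𝐤 ≡ ℕΣ.sum {r} (λ j → (1 ∸ entry 𝐤 j) ℕ.* before 𝐤 j)
𝒫-full {zero}  𝐤       = ≡.refl
𝒫-full {suc r} (k ∷ 𝐤) = ≡.cong (ℕ._+ 𝒫 (k ∷ 𝐤)) (≡.sym (ℕ.*-zeroʳ (1 ∸ toℕ k)))

𝒫-∷ʳ : ∀ {r} (𝐤 : Binary r) x → 𝒫 (𝐤 ∷ʳ x) ≡ 𝒫 𝐤 ℕ.+ (1 ∸ toℕ x) ℕ.* weight 𝐤
𝒫-∷ʳ 𝐤 x = ≡.trans (𝒫-full (𝐤 ∷ʳ x))
  (≡.trans (sum-∷ʳ ℕ.+-0-monoid (λ _ b e → (1 ∸ e) ℕ.* b) 𝐤 x)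
           (≡.cong (ℕ._+ (1 ∸ toℕ x) ℕ.* weight 𝐤) (≡.sym (𝒫-full 𝐤))))

𝒬-∷ʳ : ∀ {r} s (𝐤 : Binary r) x →
  𝒬 s (𝐤 ∷ʳ x) ≡ 𝒬 s 𝐤 ℕ.+ (1 ∸ toℕ x) ℕ.* shift s (suc r) (weight 𝐤)
𝒬-∷ʳ s = sum-∷ʳ ℕ.+-0-monoid (λ j b e → (1 ∸ e) ℕ.* shift s (suc j) b)

-- Sums over the binary vectors that satisfy a condition.

module _ {c ℓ} (R : CommutativeRing c ℓ) where

  open CommutativeRing R hiding (zero)
  open Stirling R
  open Exp semiring using (^-homo-*)
  open CommutativeMonoidSolver *-commutativeMonoid using (solve; _⊕_; _⊜_)
  open ≈-Reasoning setoid
  private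
    module Π = MonoidSum *-monoid
    module +-Props = CommutativeSemigroupProperties +-commutativeSemigroup

  -- Generalizes `sumOfWeight` to any decidable condition: after an entry is split off, the
  -- condition on the shorter vector is a pullback such as `P? ∘ (_∷ʳ 0ᵇ)`, no longer literally a
  -- prescribed weight.
  sumWhere : ∀ {a p} {A : Set a} {P : A → Set p} →
             Decidable P → (A → Carrier) → List A → Carrier
  sumWhere P? f xs = foldr _+_ 0# (map f (filter P? xs))

  module _ {a p} {A : Set a} {P : A → Set p} (P? : Decidable P) where

    sumWhere-++ : ∀ f xs ys →
      sumWhere P? f (xs ++ ys) ≈ sumWhere P? f xs + sumWhere P? f ys
    sumWhere-++ f []       ys = sym (+-identityˡ _)
    sumWhere-++ f (x ∷ xs) ys with does (P? x)
    ... | false = sumWhere-++ f xs ys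
    ... | true  = trans (+-congˡ (sumWhere-++ f xs ys)) (sym (+-assoc _ _ _))

    sumWhere-map : ∀ {b} {B : Set b} (g : B → A) f xs →
      sumWhere P? f (map g xs) ≡ sumWhere (P? ∘ g) (f ∘ g) xs
    sumWhere-map g f []       = ≡.refl
    sumWhere-map g f (x ∷ xs) with does (P? (g x))
    ... | false = sumWhere-map g f xs
    ... | true  = ≡.cong (f (g x) +_) (sumWhere-map g f xs)

    sumWhere-none : ∀ f xs → (∀ x → ¬ P x) → sumWhere P? f xs ≡ 0#
    sumWhere-none f xs ¬P =
      ≡.cong (foldr _+_ 0# ∘ map f) (filter-none P? (All.universal ¬P xs))

    -- The factor has to be right only where `P` holds: the factors produced by appending depend on
    -- the weight, which is constant only there.
    sumWhere-scale : ∀ {c f g} → (∀ x → P x → f x ≈ c * g x) → ∀ xs →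
      sumWhere P? f xs ≈ c * sumWhere P? g xs
    sumWhere-scale f≈cg []       = sym (zeroʳ _)
    sumWhere-scale f≈cg (x ∷ xs) with P? x
    ... | no  _  = sumWhere-scale f≈cg xs
    ... | yes px = trans (+-cong (f≈cg x px) (sumWhere-scale f≈cg xs)) (sym (distribˡ _ _ _))

  sumWhere-≐ : ∀ {a p p′} {A : Set a} {P : A → Set p} {P′ : A → Set p′}
    (P? : Decidable P) (P′? : Decidable P′) → P ≐ P′ →
    ∀ f xs → sumWhere P? f xs ≡ sumWhere P′? f xs
  sumWhere-≐ P? P′? P≐P′ f xs =
    ≡.cong (foldr _+_ 0# ∘ map f) (filter-≐ P? P′? P≐P′ xs)

  sumWhere-∷ : ∀ r {p} {P : Binary (suc r) → Set p} (P? : Decidable P) f →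
    sumWhere P? f (binaries (suc r)) ≈
      sumWhere (P? ∘ (0ᵇ ∷_)) (f ∘ (0ᵇ ∷_)) (binaries r) +
      sumWhere (P? ∘ (1ᵇ ∷_)) (f ∘ (1ᵇ ∷_)) (binaries r)
  sumWhere-∷ r P? f = trans
    (sumWhere-++ P? f (map (0ᵇ ∷_) (binaries r)) _)
    (+-cong
      (reflexive (sumWhere-map P? (0ᵇ ∷_) f (binaries r)))
      (reflexive (≡.trans
        -- `cartesianProductWith` leaves a trailing `[]` after its last block.
        (≡.cong (sumWhere P? f) (++-identityʳ (map (1ᵇ ∷_) (binaries r))))
        (sumWhere-map P? (1ᵇ ∷_) f (binaries r)))))

  -- `binaries` branches on the first entry, whereas the recurrence needs the last. The induction
  -- splits by both: prepending and appending commute definitionally, so the four sums indexed by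
  -- first and last entry only have to be regrouped.
  sumWhere-∷ʳ : ∀ r {p} {P : Binary (suc r) → Set p} (P? : Decidable P) f →
    sumWhere P? f (binaries (suc r)) ≈
      sumWhere (P? ∘ (_∷ʳ 0ᵇ)) (f ∘ (_∷ʳ 0ᵇ)) (binaries r) +
      sumWhere (P? ∘ (_∷ʳ 1ᵇ)) (f ∘ (_∷ʳ 1ᵇ)) (binaries r)
  sumWhere-∷ʳ zero    P? f =
    trans (sumWhere-++ P? f ((0ᵇ ∷ []) ∷ []) ((1ᵇ ∷ []) ∷ []))
      (+-cong (reflexive (sumWhere-map P? (_∷ʳ 0ᵇ) f ([] ∷ [])))
              (reflexive (sumWhere-map P? (_∷ʳ 1ᵇ) f ([] ∷ []))))
  sumWhere-∷ʳ (suc r) P? f = begin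
    sumWhere P? f (binaries (suc (suc r)))
      ≈⟨ sumWhere-∷ (suc r) P? f ⟩
    sumWhere (P? ∘ (0ᵇ ∷_)) (f ∘ (0ᵇ ∷_)) (binaries (suc r)) +
    sumWhere (P? ∘ (1ᵇ ∷_)) (f ∘ (1ᵇ ∷_)) (binaries (suc r))
      ≈⟨ +-cong (sumWhere-∷ʳ r (P? ∘ (0ᵇ ∷_)) (f ∘ (0ᵇ ∷_)))
                (sumWhere-∷ʳ r (P? ∘ (1ᵇ ∷_)) (f ∘ (1ᵇ ∷_))) ⟩
    (_ + _) + (_ + _)
      ≈⟨ +-Props.interchange _ _ _ _ ⟩
    (_ + _) + (_ + _)
      ≈⟨ +-cong (sumWhere-∷ r (P? ∘ (_∷ʳ 0ᵇ)) (f ∘ (_∷ʳ 0ᵇ)))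
                (sumWhere-∷ r (P? ∘ (_∷ʳ 1ᵇ)) (f ∘ (_∷ʳ 1ᵇ))) ⟨
    sumWhere (P? ∘ (_∷ʳ 0ᵇ)) (f ∘ (_∷ʳ 0ᵇ)) (binaries (suc r)) +
    sumWhere (P? ∘ (_∷ʳ 1ᵇ)) (f ∘ (_∷ʳ 1ᵇ)) (binaries (suc r)) ∎

  sumOfWeight-vanishes : ∀ {r w} f → r < w → sumOfWeight r w f ≈ 0#
  sumOfWeight-vanishes {r} {w} f r<w = reflexive
    (sumWhere-none (λ 𝐤 → weight 𝐤 ℕ.≟ w) f (binaries r)
      (λ 𝐤 |𝐤|≡w → ℕ.<⇒≢ (ℕ.≤-<-trans (weight≤ 𝐤) r<w) |𝐤|≡w))

  -- Recurrence for the totals over vectors of fixed weight.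

  module _ (s : ℕ) (p q : Carrier) where

    𝒜-∷ʳ : ∀ {r} (𝐤 : Binary r) x → 𝒜 s p q (𝐤 ∷ʳ x) ≈
      𝒜 s p q 𝐤 *
        Π.sum {toℕ x} (λ ℓ → [ shift s (suc r) (weight 𝐤 ℕ.+ toℕ ℓ) ]⟨ p , q ⟩)
    𝒜-∷ʳ = sum-∷ʳ *-monoid
      (λ j b e → Π.sum {e} (λ ℓ → [ shift s (suc j) (b ℕ.+ toℕ ℓ) ]⟨ p , q ⟩))

    summand : ∀ {r} → Binary r → Carrier
    summand 𝐤 = p ^ 𝒫 𝐤 * q ^ 𝒬 s 𝐤 * 𝒜 s p q 𝐤

    coefficient₀ : (r w : ℕ) → Carrier
    coefficient₀ r w = p ^ w * q ^ shift s (suc r) w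

    summand-∷ʳ0 : ∀ {r} (𝐤 : Binary r) →
      summand (𝐤 ∷ʳ 0ᵇ) ≈ coefficient₀ r (weight 𝐤) * summand 𝐤
    summand-∷ʳ0 {r} 𝐤 = begin
      p ^ 𝒫 (𝐤 ∷ʳ 0ᵇ) * q ^ 𝒬 s (𝐤 ∷ʳ 0ᵇ) * 𝒜 s p q (𝐤 ∷ʳ 0ᵇ)
        ≈⟨ *-cong (*-cong (power p (𝒫 𝐤) w (𝒫-∷ʳ 𝐤 0ᵇ))
                          (power q (𝒬 s 𝐤) (shift s (suc r) w) (𝒬-∷ʳ s 𝐤 0ᵇ)))
                  (trans (𝒜-∷ʳ 𝐤 0ᵇ) (*-identityʳ _)) ⟩
      p ^ 𝒫 𝐤 * p ^ w * (q ^ 𝒬 s 𝐤 * q ^ shift s (suc r) w) * 𝒜 s p q 𝐤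
        ≈⟨ solve 5 (λ a b c d e → ((a ⊕ b) ⊕ (c ⊕ d)) ⊕ e ⊜ (b ⊕ d) ⊕ ((a ⊕ c) ⊕ e))
             refl (p ^ 𝒫 𝐤) (p ^ w) (q ^ 𝒬 s 𝐤) (q ^ shift s (suc r) w) (𝒜 s p q 𝐤) ⟩
      coefficient₀ r w * summand 𝐤 ∎
      where
      w = weight 𝐤
      power : ∀ x {a} b c → a ≡ b ℕ.+ 1 ℕ.* c → x ^ a ≈ x ^ b * x ^ c
      power x b c ≡.refl = trans (^-homo-* x b (1 ℕ.* c))
        (*-congˡ (reflexive (≡.cong (x ^_) (ℕ.*-identityˡ c))))

    summand-∷ʳ1 : ∀ {r} (𝐤 : Binary r) →
      summand (𝐤 ∷ʳ 1ᵇ) ≈ [ shift s (suc r) (weight 𝐤) ]⟨ p , q ⟩ * summand 𝐤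
    summand-∷ʳ1 {r} 𝐤 = begin
      p ^ 𝒫 (𝐤 ∷ʳ 1ᵇ) * q ^ 𝒬 s (𝐤 ∷ʳ 1ᵇ) * 𝒜 s p q (𝐤 ∷ʳ 1ᵇ)
        ≈⟨ *-cong (*-cong (power p (𝒫 𝐤) (𝒫-∷ʳ 𝐤 1ᵇ)) (power q (𝒬 s 𝐤) (𝒬-∷ʳ s 𝐤 1ᵇ)))
                  -- The new inner product of `𝒜` has the single index ℓ = 0, which leaves
                  -- `w ℕ.+ 0`.
                  (trans (𝒜-∷ʳ 𝐤 1ᵇ) (*-congˡ (trans (*-identityʳ _)
                    (reflexive (≡.cong (λ m → [ shift s (suc r) m ]⟨ p , q ⟩)
                                       (ℕ.+-identityʳ w)))))) ⟩
      p ^ 𝒫 𝐤 * q ^ 𝒬 s 𝐤 * (𝒜 s p q 𝐤 * [ shift s (suc r) w ]⟨ p , q ⟩)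
        ≈⟨ trans (sym (*-assoc _ _ _)) (*-comm _ _) ⟩
      [ shift s (suc r) w ]⟨ p , q ⟩ * summand 𝐤 ∎
      where
      w = weight 𝐤
      power : ∀ x {a} b → a ≡ b ℕ.+ 0 → x ^ a ≈ x ^ b
      power x b ≡.refl = reflexive (≡.cong (x ^_) (ℕ.+-identityʳ b))

    total : (r w : ℕ) → Carrier
    total r w = sumOfWeight r w summand

    total-∷ʳ0 : ∀ r w →
      sumWhere (λ 𝐤 → weight (𝐤 ∷ʳ 0ᵇ) ℕ.≟ w) (summand ∘ (_∷ʳ 0ᵇ)) (binaries r) ≈
      coefficient₀ r w * total r w
    total-∷ʳ0 r w = trans
      (reflexive (sumWhere-≐ _ (λ 𝐤 → weight 𝐤 ℕ.≟ w)
        ( (λ {𝐤} → ≡.trans (≡.sym (weight-∷ʳ 𝐤 0ᵇ)))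
        , (λ {𝐤} → ≡.trans (weight-∷ʳ 𝐤 0ᵇ)))
        _ (binaries r)))
      -- Matching on `≡.refl` identifies w with the weight of 𝐤, so the factor from `summand-∷ʳ0` is
      -- the same for all 𝐤 in the sum.
      (sumWhere-scale _ (λ { 𝐤 ≡.refl → summand-∷ʳ0 𝐤 }) (binaries r))

    total-∷ʳ1 : ∀ r w →
      sumWhere (λ 𝐤 → weight (𝐤 ∷ʳ 1ᵇ) ℕ.≟ suc w) (summand ∘ (_∷ʳ 1ᵇ)) (binaries r) ≈
      [ shift s (suc r) w ]⟨ p , q ⟩ * total r w
    total-∷ʳ1 r w = trans
      (reflexive (sumWhere-≐ _ (λ 𝐤 → weight 𝐤 ℕ.≟ w)
        ( (λ {𝐤} eq → ℕ.suc-injective (≡.trans (≡.sym (weight-∷ʳ 𝐤 1ᵇ)) eq))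
        , (λ {𝐤} eq → ≡.trans (weight-∷ʳ 𝐤 1ᵇ) (≡.cong suc eq)))
        _ (binaries r)))
      (sumWhere-scale _ (λ { 𝐤 ≡.refl → summand-∷ʳ1 𝐤 }) (binaries r))

    -- A vector ending in 1 has positive weight, so only those ending in 0 contribute.
    total-zero : ∀ r → total (suc r) 0 ≈ coefficient₀ r 0 * total r 0
    total-zero r = begin
      total (suc r) 0
        ≈⟨ sumWhere-∷ʳ r (λ 𝐤 → weight 𝐤 ℕ.≟ 0) summand ⟩
      _ + _
        ≈⟨ +-cong (total-∷ʳ0 r 0)
             (reflexive (sumWhere-none (λ 𝐤 → weight (𝐤 ∷ʳ 1ᵇ) ℕ.≟ 0) _ (binaries r)
               (λ 𝐤 eq → ℕ.1+n≢0 (≡.trans (≡.sym (weight-∷ʳ 𝐤 1ᵇ)) eq)))) ⟩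
      coefficient₀ r 0 * total r 0 + 0#
        ≈⟨ +-identityʳ _ ⟩
      coefficient₀ r 0 * total r 0 ∎

    total-suc : ∀ r w → total (suc r) (suc w) ≈
      coefficient₀ r (suc w) * total r (suc w) + [ shift s (suc r) w ]⟨ p , q ⟩ * total r w
    total-suc r w = trans
      (sumWhere-∷ʳ r (λ 𝐤 → weight 𝐤 ℕ.≟ suc w) summand)
      (+-cong (total-∷ʳ0 r (suc w)) (total-∷ʳ1 r w))

    -- Comparison of the totals with the Stirling numbers.

    module _ (h : Carrier) where

      -- The first step has the factor [s * 0] = [0], an empty sum; every later step multiplies the
      -- previous value.
      𝔖-zero : ∀ n → 𝔖 s h p q (suc n) 0 ≈ 0#
      𝔖-zero zero    = trans (*-identityʳ _) (trans
        (*-congˡ (reflexive (≡.cong (λ e → [ e ]⟨ p , q ⟩) (ℕ.*-zeroʳ s)))) (zeroʳ h))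
      𝔖-zero (suc n) = trans (*-congˡ (𝔖-zero n)) (zeroʳ _)

      -- Taking m + 1 = n - k as a parameter removes the truncated subtractions, and the exponent of
      -- q and the bracket become values of `shift` at n, as in `total-suc` with n = r + 1.
      𝔖-suc : ∀ {n} m k → suc m ℕ.+ k ≡ n → 𝔖 s h p q (suc n) (suc k) ≈
        p ^ suc m * q ^ shift s n (suc m) * 𝔖 s h p q n k +
        h * [ shift s n m ]⟨ p , q ⟩ * 𝔖 s h p q n (suc k)
      𝔖-suc m k ≡.refl = +-cong
        (*-congʳ (*-cong
          (reflexive (≡.cong (p ^_) (ℕ.m+n∸n≡m (suc m) k)))
          (reflexive (≡.cong (q ^_) (≡.trans
            (≡.cong (λ e → s ℕ.* e ℕ.+ k) (ℕ.m+n∸n≡m (suc m) k))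
            (≡.sym (shift-+ s (suc m) k)))))))
        (*-congʳ (*-congˡ (reflexive (≡.cong (λ e → [ e ]⟨ p , q ⟩) (≡.trans
          (≡.cong (λ e → s ℕ.* e ℕ.+ suc k) (ℕ.m+n∸n≡m m k))
          (≡.trans (≡.sym (shift-+ s m (suc k)))
                   (≡.cong (λ n → shift s n m) (ℕ.+-suc m k))))))))

      -- The case n = k, which `𝔖-suc` leaves out: the second term of the recurrence contains
      -- `𝔖 s h p q n (suc n)`, which vanishes.
      𝔖-diagonal : ∀ n → 𝔖 s h p q (suc n) (suc n) ≈
        p ^ 0 * q ^ shift s n 0 * 𝔖 s h p q n n
      𝔖-diagonal n = trans
        (+-cong (*-congʳ (*-cong
                   (reflexive (≡.cong (p ^_) (ℕ.n∸n≡0 n)))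
                   (reflexive (≡.cong (q ^_) (≡.trans
                     (≡.cong (λ e → s ℕ.* e ℕ.+ n) (ℕ.n∸n≡0 n)) (≡.sym (shift-+ s 0 n)))))))
                (trans (*-congˡ (𝔖-vanishes s h p q (ℕ.n<1+n n))) (zeroʳ _)))
        (+-identityʳ _)

      -- Induction on r: multiplied by `h ^ w`, the totals obey the recurrence for `𝔖`, where w
      -- stands for n - k with n = r + 1. The case k = 0 belongs to the induction, since `suc k`
      -- calls on k; there both sides are 0, because no vector of length r has weight r + 1.
      𝔖-total : ∀ r w k → w ℕ.+ k ≡ suc r → 𝔖 s h p q (suc r) k ≈ h ^ w * total r w
      𝔖-total r w zero eq = trans (𝔖-zero r) (sym (trans
        (*-congˡ (sumOfWeight-vanishes summand
          (ℕ.≤-reflexive (≡.trans (≡.sym eq) (ℕ.+-identityʳ w)))))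
        (zeroʳ _)))
      -- The induction starts at n = k = 1: the only vector is empty, and its summand is 1.
      𝔖-total zero zero (suc zero) eq = trans (𝔖-diagonal 0) (begin
        1# * q ^ shift s 0 0 * 1#
          ≈⟨ *-congʳ (*-congˡ (reflexive (≡.cong (q ^_) (ℕ.*-zeroʳ s)))) ⟩
        1# * 1# * 1#             ≈⟨ +-identityʳ _ ⟨
        1# * 1# * 1# + 0#        ≈⟨ *-identityˡ _ ⟨
        1# * (1# * 1# * 1# + 0#) ∎)
      𝔖-total zero (suc w) (suc k) eq =
        contradiction (≡.trans (≡.sym (ℕ.+-suc w k)) (ℕ.suc-injective eq)) ℕ.1+n≢0
      𝔖-total (suc r) zero .(suc (suc r)) ≡.refl = begin
        𝔖 s h p q (suc (suc r)) (suc (suc r))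
          ≈⟨ 𝔖-diagonal (suc r) ⟩
        coefficient₀ r 0 * 𝔖 s h p q (suc r) (suc r)
          ≈⟨ *-congˡ (trans (𝔖-total r 0 (suc r) ≡.refl) (*-identityˡ _)) ⟩
        coefficient₀ r 0 * total r 0
          ≈⟨ trans (*-identityˡ _) (total-zero r) ⟨
        1# * total (suc r) 0 ∎
      𝔖-total (suc r) (suc w) (suc k) eq = begin
        𝔖 s h p q (suc (suc r)) (suc k)
          ≈⟨ 𝔖-suc w k sw+k ⟩
        coefficient₀ r (suc w) * 𝔖 s h p q (suc r) k + h * b * 𝔖 s h p q (suc r) (suc k)
          ≈⟨ +-cong (*-congˡ (𝔖-total r (suc w) k sw+k))
                    (*-congˡ (𝔖-total r w (suc k) w+sk)) ⟩
        coefficient₀ r (suc w) * (h ^ suc w * total r (suc w)) + h * b * (h ^ w * total r w)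
          -- Both terms carry `h ^ suc w`: the first from the total of weight w + 1, the second from
          -- `h ^ w` and the h of the recurrence.
          ≈⟨ +-cong
               (solve 3 (λ l x t → l ⊕ (x ⊕ t) ⊜ x ⊕ (l ⊕ t)) refl
                 (coefficient₀ r (suc w)) (h ^ suc w) (total r (suc w)))
               (solve 4 (λ x y z t → (x ⊕ y) ⊕ (z ⊕ t) ⊜ (x ⊕ z) ⊕ (y ⊕ t)) refl
                 h b (h ^ w) (total r w)) ⟩
        h ^ suc w * (coefficient₀ r (suc w) * total r (suc w)) + h ^ suc w * (b * total r w)
          ≈⟨ distribˡ _ _ _ ⟨
        h ^ suc w * (coefficient₀ r (suc w) * total r (suc w) + b * total r w)
          ≈⟨ *-congˡ (total-suc r w) ⟨
        h ^ suc w * total (suc r) (suc w) ∎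
        where
        b = [ shift s (suc r) w ]⟨ p , q ⟩
        w+sk : w ℕ.+ suc k ≡ suc r
        w+sk = ℕ.suc-injective eq
        sw+k : suc w ℕ.+ k ≡ suc r
        sw+k = ≡.trans (≡.sym (ℕ.+-suc w k)) w+sk

proposition3p7 : ∀ {c ℓ} (R : CommutativeRing c ℓ) →
    let open CommutativeRing R
        open Stirling R
    in
    (s : ℕ) (h p q : Carrier) → ¬ (h ≈ 0#) →
    (n k : ℕ) → 1 ≤ n → 1 ≤ k → k ≤ n →
    𝔖 s h p q n k ≈
      h ^ (n ∸ k) * sumOfWeight (n ∸ 1) (n ∸ k)
        (λ 𝐤 → p ^ 𝒫 𝐤 * q ^ 𝒬 s 𝐤 * 𝒜 s p q 𝐤)
-- Here r = n - 1 and w = n - k; `k≤n` makes the latter subtraction exact, so that w + k = n.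
proposition3p7 R s h p q _ (suc r) k _ _ k≤n =
  𝔖-total R s p q h r (suc r ∸ k) k (ℕ.m∸n+n≡m k≤n)
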